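{- Let $\mathcal{C}$ be a $[km,k,m]_{q^m/q}$ simplex rank-metric code. Then $\mathcal{C}$ is minimal.
   Context: Let $q$ be a prime power, $m\ge 1$ and $k\ge2$ integers. For $v\in\mathbb{F}_{q^m}^n$ and an ordered basis $\Gamma=(\gamma_1,\dots,\gamma_m)$ of $\mathbb{F}_{q^m}$ over $\mathbb{F}_q$, let $\Gamma(v)\in\mathbb{F}_q^{n\times m}$ be the matrix with $v_i=\sum_{j}\Gamma(v)_{ij}\gamma_j$. The rank support $\sigma^{\mathrm{rk}}(v)\subseteq\mathbb{F}_q^n$ is the column space of $\Gamma(v)$ (independent of $\Gamma$), and $\mathrm{rk}(v)=\dim_{\mathbb{F}_q}\sigma^{\mathrm{rk}}(v)$. An $[n,k,d]_{q^m/q}$ code is a $k$-dimensional $\mathbb{F}_{q^m}$-subspace of $\mathbb{F}_{q^m}^n$ whose nonzero codewords have minimum rank $d$; $d$ is omitted when irrelevant. A code is nondegenerate if $\sum_{v\in\mathcal{C}}\sigma^{\mathrm{rk}}(v)=\mathbb{F}_q^n$. A simplex rank-metric code is a nondegenerate $[km,k]_{q^m/q}$ code with $k\ge2$; equivalently, a $[km,k]_{q^m/q}$ code such that the $\mathbb{F}_q$-span of the columns of a generator matrix is all of $\mathbb{F}_{q^m}^k$ (all of its nonzero codewords then have rank $m$). A code $\mathcal{C}$ is minimal if for all $v,v'\in\mathcal{C}$, $\sigma^{\mathrm{rk}}(v')\subseteq\sigma^{\mathrm{rk}}(v)$ implies $v'=\alpha v$ for some $\alpha\in\mathbb{F}_{q^m}$.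 -}

module Defs where

open import Level using (Level; _⊔_) renaming (suc to lsuc)
open import Algebra.Bundles using (CommutativeRing)
open import Algebra.Bundles.Raw using (RawRing)
open import Algebra.Apartness.Bundles using (HeytingField; HeytingCommutativeRing)
open import Algebra.Module.Bundles.Raw using (RawLeftModule)
open import Algebra.Morphism.Structures using (IsRingHomomorphism)
import Algebra.Definitions.RawMonoid as RawMonoidDefs
open import Data.Fin.Base using (Fin)
open import Data.Nat.Base using (ℕ; _^_; _*_; _≤_)
open import Data.Nat.Primality using (Prime)
open import Data.Product.Base using (Σ-syntax; ∃-syntax; _×_; proj₁)
open import Data.Vec.Functional using (Vector; zipWith; map; replicate; transpose)
open import Data.Vec.Functional.Relation.Binary.Pointwise using (Pointwise)
open import Function.Bundles using (Inverse)
open import Relation.Binary.Bundles using (Setoid)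
open import Relation.Binary.PropositionalEquality using (_≡_; setoid)
open import Relation.Unary using (Pred; _∈_; _⊆_; _≐_; U)

IsPrimePower : ℕ → Set
IsPrimePower q = ∃[ p ] ∃[ e ] (Prime p × 1 ≤ e × q ≡ p ^ e)

module Linear {r ℓr v ℓv} (R : RawRing r ℓr)
              (V : RawLeftModule (RawRing.Carrier R) v ℓv) where
  private module R = RawRing R
  open RawLeftModule V
  open RawMonoidDefs +ᴹ-rawMonoid using (sum)

  lincomb : ∀ {s} → Vector R.Carrier s → Vector Carrierᴹ s → Carrierᴹ
  lincomb a b = sum (zipWith _*ₗ_ a b)

  Span : ∀ {s} → Vector Carrierᴹ s → Pred Carrierᴹ (r ⊔ ℓv)
  Span b x = ∃[ a ] x ≈ᴹ lincomb a b

  LinearlyIndependent : ∀ {s} → Vector Carrierᴹ s → Set (r ⊔ ℓr ⊔ ℓv)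
  LinearlyIndependent b =
    ∀ a → lincomb a b ≈ᴹ 0ᴹ → ∀ i → a i R.≈ R.0#

  record IsSubspace {p} (W : Pred Carrierᴹ p) : Set (r ⊔ v ⊔ ℓv ⊔ p) where
    field
      resp-≈ : ∀ {x y} → x ≈ᴹ y → x ∈ W → y ∈ W
      0-mem  : 0ᴹ ∈ W
      +-mem  : ∀ {x y} → x ∈ W → y ∈ W → (x +ᴹ y) ∈ W
      *-mem  : ∀ a {x} → x ∈ W → (a *ₗ x) ∈ W

  record IsBasisOf {p} (W : Pred Carrierᴹ p) {s} (b : Vector Carrierᴹ s)
         : Set (r ⊔ ℓr ⊔ v ⊔ ℓv ⊔ p) where
    field
      members     : ∀ i → b i ∈ W
      independent : LinearlyIndependent b
      spanning    : W ⊆ Span b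

  HasDimension : ∀ {p} → Pred Carrierᴹ p → ℕ → Set (r ⊔ ℓr ⊔ v ⊔ ℓv ⊔ p)
  HasDimension W d = Σ[ b ∈ Vector Carrierᴹ d ] IsBasisOf W b

  -- Sum of the possibly infinite family of subspaces S i with i ∈ I: all
  -- finite sums of elements of the members.
  SumOver : ∀ {a p s} {A : Set a} → Pred A p → (A → Pred Carrierᴹ s) →
            Pred Carrierᴹ (a ⊔ p ⊔ v ⊔ ℓv ⊔ s)
  SumOver {A = A} I S x =
    ∃[ t ] Σ[ i ∈ Vector A t ] Σ[ y ∈ Vector Carrierᴹ t ]
      ((∀ j → i j ∈ I) × (∀ j → y j ∈ S (i j)) × x ≈ᴹ sum y)

module FieldOps {c ℓ₁ ℓ₂} (F : HeytingField c ℓ₁ ℓ₂) where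
  open HeytingField F using (heytingCommutativeRing)
  open HeytingCommutativeRing heytingCommutativeRing using (commutativeRing)
  open CommutativeRing commutativeRing public using (rawRing)
    renaming (setoid to ≈-setoid)
  open RawRing rawRing renaming (_*_ to _·_)

  vectorSpace : ℕ → RawLeftModule Carrier c ℓ₁
  vectorSpace n = record
    { Carrierᴹ = Vector Carrier n
    ; _≈ᴹ_     = Pointwise _≈_
    ; _+ᴹ_     = zipWith _+_
    ; _*ₗ_     = λ a → map (a ·_)
    ; 0ᴹ       = replicate n 0#
    ; -ᴹ_      = map (-_)
    }

-- The extension 𝔽_{q^m} / 𝔽_q. Finiteness makes ≈ and invertibility decidable,
-- so x # y is equivalent to ¬ (x ≈ y) and a finite Heyting field is exactly a
-- finite field; in particular ι is injective.
record FiniteFieldExtension (q m : ℕ) (a ℓa ℓa′ b ℓb ℓb′ : Level)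
       : Set (lsuc (a ⊔ ℓa ⊔ ℓa′ ⊔ b ⊔ ℓb ⊔ ℓb′)) where
  field
    K : HeytingField a ℓa ℓa′
    L : HeytingField b ℓb ℓb′

  module K = FieldOps K
  module L = FieldOps L
  open RawRing K.rawRing public using () renaming (Carrier to 𝕂)
  open RawRing L.rawRing public using () renaming (Carrier to 𝕃)

  field
    K-order           : Inverse K.≈-setoid (setoid (Fin q))
    L-order           : Inverse L.≈-setoid (setoid (Fin (q ^ m)))
    ι                 : 𝕂 → 𝕃
    ι-isHomomorphism  : IsRingHomomorphism K.rawRing L.rawRing ι

  L-over-K : RawLeftModule 𝕂 b ℓb
  L-over-K = record
    { Carrierᴹ = 𝕃
    ; _≈ᴹ_     = RawRing._≈_ L.rawRing
    ; _+ᴹ_     = RawRing._+_ L.rawRing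
    ; _*ₗ_     = λ x y → RawRing._*_ L.rawRing (ι x) y
    ; 0ᴹ       = RawRing.0# L.rawRing
    ; -ᴹ_      = RawRing.-_ L.rawRing
    }

  record OrderedBasis : Set (a ⊔ ℓa ⊔ b ⊔ ℓb) where
    field
      γ       : Vector 𝕃 m
      isBasis : Linear.IsBasisOf K.rawRing L-over-K U γ

module RankMetric {q m a ℓa ℓa′ b ℓb ℓb′}
                  (E : FiniteFieldExtension q m a ℓa ℓa′ b ℓb ℓb′)
                  (Γ : FiniteFieldExtension.OrderedBasis E) where
  open FiniteFieldExtension E
  open OrderedBasis Γ
  open Linear.IsBasisOf isBasis using (spanning)

  module _ {n : ℕ} where
    private
      module Kⁿ = Linear K.rawRing (K.vectorSpace n)
      module Lⁿ = Linear L.rawRing (L.vectorSpace n)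
    open RawLeftModule (L.vectorSpace n)

    -- Row i holds the Γ-coordinates of v i, which linear independence of Γ makes
    -- unique up to ≈.
    coordinateMatrix : Vector 𝕃 n → Vector (Vector 𝕂 m) n
    coordinateMatrix v i = proj₁ (spanning {v i} _)

    σ : Vector 𝕃 n → Pred (Vector 𝕂 n) (a ⊔ ℓa)
    σ v = Kⁿ.Span (transpose (coordinateMatrix v))

    HasRank : Vector 𝕃 n → ℕ → Set (a ⊔ ℓa)
    HasRank v = Kⁿ.HasDimension (σ v)

    record HasMinimumRank {p} (C : Pred (Vector 𝕃 n) p) (d : ℕ)
           : Set (a ⊔ ℓa ⊔ b ⊔ ℓb ⊔ p) where
      field
        attained   : ∃[ v ] (v ∈ C × v ≉ᴹ 0ᴹ × HasRank v d)
        lowerBound : ∀ {v r} → v ∈ C → v ≉ᴹ 0ᴹ → HasRank v r → d ≤ r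

    record IsCode {p} (k : ℕ) (C : Pred (Vector 𝕃 n) p)
           : Set (b ⊔ ℓb ⊔ p) where
      field
        isSubspace : Lⁿ.IsSubspace C
        dimension  : Lⁿ.HasDimension C k

    record IsCodeOfDistance {p} (k d : ℕ) (C : Pred (Vector 𝕃 n) p)
           : Set (a ⊔ ℓa ⊔ b ⊔ ℓb ⊔ p) where
      field
        isCode      : IsCode k C
        minimumRank : HasMinimumRank C d

    Nondegenerate : ∀ {p} → Pred (Vector 𝕃 n) p → Set (a ⊔ ℓa ⊔ b ⊔ p)
    Nondegenerate C = Kⁿ.SumOver C σ ≐ U

    Minimal : ∀ {p} → Pred (Vector 𝕃 n) p → Set (a ⊔ ℓa ⊔ b ⊔ ℓb ⊔ p)
    Minimal C = ∀ {v v′} → v ∈ C → v′ ∈ C → σ v′ ⊆ σ v →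
                ∃[ α ] (v′ ≈ᴹ α *ₗ v)

  record IsSimplex {p} (k : ℕ) (C : Pred (Vector 𝕃 (k * m)) p)
         : Set (a ⊔ ℓa ⊔ b ⊔ ℓb ⊔ p) where
    field
      isCode        : IsCode k C
      nondegenerate : Nondegenerate C
      k≥2           : 2 ≤ k

{-# OPTIONS --safe #-}
-- Fix a basis g₁, …, gₖ of the code, and for x in 𝔽_q^n (n = km) let
-- φ x = (⟨x , g₁⟩, …, ⟨x , gₖ⟩) in 𝔽_{q^m}^k, where ⟨x , v⟩ = Σⱼ xⱼ vⱼ.
-- The orthogonal complement of σ(v) is { x | ⟨x , v⟩ = 0 }, so nondegeneracy
-- makes φ injective, and as both sides have q^{km} elements, φ is onto.
-- For v = Σ aᵢ gᵢ we have ⟨x , v⟩ = a · φ x. Hence σ(v′) ⊆ σ(v) says that every y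
-- with a · y = 0 satisfies a′ · y = 0, which forces a′ to be a multiple of a.
module Submission where

open import Defs
open import Algebra.Apartness.Bundles using (HeytingField; HeytingCommutativeRing)
open import Algebra.Bundles using (CommutativeRing)
open import Algebra.Module.Bundles.Raw using (RawLeftModule)
open import Algebra.Morphism.Structures using (IsRingHomomorphism)
import Algebra.Definitions.RawMonoid as RawMonoidDefs
import Algebra.Properties.CommutativeSemigroup as CommutativeSemigroupProperties
import Algebra.Properties.Group as GroupProperties
import Algebra.Properties.Ring as RingProperties
import Algebra.Properties.Semiring.Sum as SemiringSum
open import Data.Empty using (⊥-elim)
open import Data.Fin.Base using (Fin; zero; suc; punchOut; finToFun; funToFin; combine)
open import Data.Fin.Properties
  using (_≟_; any?; punchOut-injective; <⇒notInjective; finToFun-funToFin; funToFin-finToFin)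
open import Data.Nat.Base using (ℕ; zero; suc; _*_; _≤_; _^_)
open import Data.Nat.Properties using (n<1+n; ^-*-assoc; *-comm)
open import Data.Product.Base using (∃-syntax; _,_; proj₁; proj₂)
open import Data.Vec.Functional using (Vector; _∷_; replicate; map; zipWith)
open import Function.Base using (_∘_)
open import Function.Bundles using (Inverse; Injection)
open import Function.Definitions using (Injective)
open import Function.Properties.Inverse using (Inverse⇒Injection)
open import Level using (Level)
open import Relation.Binary.Core using (Rel)
open import Relation.Binary.Definitions using (Decidable)
open import Relation.Binary.PropositionalEquality using (_≡_; refl; sym; trans; cong; cong₂; setoid)
import Relation.Binary.Reasoning.Setoid as SetoidReasoning
open import Relation.Nullary.Decidable using (Dec; yes; no; map′; via-injection)
open import Relation.Nullary.Negation using (¬_)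
open import Relation.Unary using (Pred; _∈_; _⊆_)

-- Counting: injective maps between finite sets of equal size.

Fin-injective⇒surjective : ∀ {n} {f : Fin n → Fin n} → Injective _≡_ _≡_ f →
                           ∀ y → ∃[ x ] f x ≡ y
Fin-injective⇒surjective {suc n} {f} inj y with any? (λ x → f x ≟ y)
... | yes hit = hit
-- If `y` were missed, deleting it from the codomain would leave an injection of `Fin (suc n)` into
-- `Fin n`, against the pigeonhole principle.
... | no miss = ⊥-elim (<⇒notInjective (n<1+n n) avoid-y-injective)
  where
  y≢f : ∀ x → ¬ y ≡ f x
  y≢f x y≡fx = miss (x , sym y≡fx)

  avoid-y : Fin (suc n) → Fin n
  avoid-y x = punchOut (y≢f x)

  avoid-y-injective : Injective _≡_ _≡_ avoid-y
  avoid-y-injective {x} {x′} eq = inj (punchOut-injective (y≢f x) (y≢f x′) eq)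

-- `e` bounds the size of `A` from below by `M` and `g` bounds that of `B` from above by `N`. For
-- `M` equal to `N` the composite of `e`, `f` and `g` is an injective self-map of a finite set, so
-- it reaches `g y`, and injectivity of `g` lifts this to `B`.
finite-injective⇒surjective :
  ∀ {a ℓa b ℓb M N} {A : Set a} {B : Set b} {_≈₁_ : Rel A ℓa} {_≈₂_ : Rel B ℓb}
  {e : Fin M → A} {f : A → B} {g : B → Fin N} → M ≡ N →
  Injective _≡_ _≈₁_ e → Injective _≈₁_ _≈₂_ f → Injective _≈₂_ _≡_ g →
  ∀ y → ∃[ x ] (f x ≈₂ y)
finite-injective⇒surjective {e = e} {g = g} refl e-inj f-inj g-inj y
  with Fin-injective⇒surjective (e-inj ∘ f-inj ∘ g-inj) (g y)
... | i , eq = e i , g-inj eq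

funToFin-injective : ∀ {s n} (f g : Fin s → Fin n) →
                     funToFin f ≡ funToFin g → ∀ i → f i ≡ g i
funToFin-injective f g eq i =
  trans (sym (finToFun-funToFin f i))
        (trans (cong (λ z → finToFun z i) eq) (finToFun-funToFin g i))

-- Functions are compared pointwise, so this takes an induction over the digits.
funToFin-cong : ∀ {s n} {f g : Fin s → Fin n} → (∀ i → f i ≡ g i) → funToFin f ≡ funToFin g
funToFin-cong {zero}  eq = refl
funToFin-cong {suc s} eq = cong₂ combine (eq zero) (funToFin-cong (eq ∘ suc))

finToFun-injective : ∀ {s n} (x y : Fin (n ^ s)) →
                     (∀ i → finToFun {n} {s} x i ≡ finToFun y i) → x ≡ y
finToFun-injective {s} {n} x y eq =
  trans (sym (funToFin-finToFin {s} {n} x))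
        (trans (funToFin-cong eq) (funToFin-finToFin {s} {n} y))

-- Dot products over a commutative ring.

module DotProduct {c ℓ} (R : CommutativeRing c ℓ) where
  open CommutativeRing R hiding (zero)
    renaming (_*_ to _·_; *-comm to ·-comm; refl to ≈-refl; sym to ≈-sym; trans to ≈-trans;
              setoid to ≈-setoid)
  open SemiringSum semiring
  open SetoidReasoning ≈-setoid
  open CommutativeSemigroupProperties *-commutativeSemigroup using (x∙yz≈y∙xz)

  dot : ∀ {n} → Vector Carrier n → Vector Carrier n → Carrier
  dot x y = sum (zipWith _·_ x y)

  unitVector : ∀ {n} → Fin n → Vector Carrier n
  unitVector {suc n} zero    = 1# ∷ replicate n 0#
  unitVector {suc n} (suc i) = 0# ∷ unitVector i

  dot-cong : ∀ {n} {x x′ y y′ : Vector Carrier n} →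
             (∀ i → x i ≈ x′ i) → (∀ i → y i ≈ y′ i) → dot x y ≈ dot x′ y′
  dot-cong x≈x′ y≈y′ = sum-cong-≋ (λ i → *-cong (x≈x′ i) (y≈y′ i))

  dot-congˡ : ∀ {n} (x : Vector Carrier n) {y y′ : Vector Carrier n} →
              (∀ i → y i ≈ y′ i) → dot x y ≈ dot x y′
  dot-congˡ x = dot-cong {x = x} (λ _ → ≈-refl)

  dot-comm : ∀ {n} (x y : Vector Carrier n) → dot x y ≈ dot y x
  dot-comm x y = sum-cong-≋ (λ i → ·-comm (x i) (y i))

  dot-zeroʳ : ∀ {n} (x : Vector Carrier n) → dot x (replicate n 0#) ≈ 0#
  dot-zeroʳ {n} x = ≈-trans (sum-cong-≋ (λ i → zeroʳ (x i))) (sum-replicate-zero n)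

  dot-+ : ∀ {n} (x y z : Vector Carrier n) → dot x (zipWith _+_ y z) ≈ dot x y + dot x z
  dot-+ x y z = ≈-trans (sum-cong-≋ (λ i → distribˡ (x i) (y i) (z i)))
                        (∑-distrib-+ (zipWith _·_ x y) (zipWith _·_ x z))

  dot-scale : ∀ {n} (x : Vector Carrier n) a y → dot x (map (a ·_) y) ≈ a · dot x y
  dot-scale x a y = ≈-trans (sum-cong-≋ (λ i → x∙yz≈y∙xz (x i) a (y i)))
                            (≈-sym (*-distribˡ-sum a (zipWith _·_ x y)))

  dot-unitVector : ∀ {n} (x : Vector Carrier n) i → dot x (unitVector i) ≈ x i
  dot-unitVector x zero    = ≈-trans (+-cong (*-identityʳ _) (dot-zeroʳ (x ∘ suc))) (+-identityʳ _)
  dot-unitVector x (suc i) = ≈-trans (+-cong (zeroʳ _) (dot-unitVector (x ∘ suc) i)) (+-identityˡ _)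

  -- Both sides are the double sum of `x j · y i · A i j`, taken in the two orders.
  dot-swap : ∀ {n s} (x : Vector Carrier n) (y : Vector Carrier s) (A : Vector (Vector Carrier n) s) →
             dot x (λ j → dot y (λ i → A i j)) ≈ dot y (λ i → dot x (A i))
  dot-swap x y A = begin
    sum (λ j → x j · sum (λ i → y i · A i j))
      ≈⟨ sum-cong-≋ (λ j → *-distribˡ-sum (x j) (λ i → y i · A i j)) ⟩
    sum (λ j → sum (λ i → x j · (y i · A i j)))
      ≈⟨ ∑-comm (λ j i → x j · (y i · A i j)) ⟩
    sum (λ i → sum (λ j → x j · (y i · A i j)))
      ≈⟨ sum-cong-≋ (λ i → sum-cong-≋ (λ j → x∙yz≈y∙xz (x j) (y i) (A i j))) ⟩
    sum (λ i → sum (λ j → y i · (x j · A i j)))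
      ≈⟨ sum-cong-≋ (λ i → *-distribˡ-sum (y i) (λ j → x j · A i j)) ⟨
    sum (λ i → y i · sum (λ j → x j · A i j))    ∎

-- Linear combinations and orthogonality over a finite field.

module FiniteField {c ℓ₁ ℓ₂} (F : HeytingField c ℓ₁ ℓ₂) where
  commutativeRing : CommutativeRing c ℓ₁
  commutativeRing = HeytingCommutativeRing.commutativeRing (HeytingField.heytingCommutativeRing F)

  open HeytingField F using (_#_; tight; #⇒invertible)
  open CommutativeRing commutativeRing hiding (zero)
    renaming (_*_ to _·_; *-comm to ·-comm; refl to ≈-refl; sym to ≈-sym; trans to ≈-trans;
              setoid to ≈-setoid)
  open DotProduct commutativeRing public
  open RingProperties ring using (-0#≈0#; -‿distribˡ-*)
  open GroupProperties +-group using (x∙y⁻¹≈ε⇒x≈y)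
  open SetoidReasoning ≈-setoid

  private
    module Fⁿ n = Linear rawRing (FieldOps.vectorSpace F n)
    sumⁿ : ∀ {n s} → Vector (Vector Carrier n) s → Vector Carrier n
    sumⁿ {n} = RawMonoidDefs.sum (RawLeftModule.+ᴹ-rawMonoid (FieldOps.vectorSpace F n))

  -- Links sums in the vector space to sums of scalars, so that linear combinations can be treated
  -- as dot products coordinate by coordinate.
  sumⁿ-pointwise : ∀ {n s} (A : Vector (Vector Carrier n) s) j →
                   sumⁿ A j ≡ SemiringSum.sum semiring (λ i → A i j)
  sumⁿ-pointwise {s = zero}  A j = refl
  sumⁿ-pointwise {s = suc s} A j = cong (A zero j +_) (sumⁿ-pointwise (A ∘ suc) j)

  lincomb-pointwise : ∀ {n s} (a : Vector Carrier s) (A : Vector (Vector Carrier n) s) j →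
                      Fⁿ.lincomb n a A j ≡ dot a (λ i → A i j)
  lincomb-pointwise a A = sumⁿ-pointwise (zipWith (λ z → map (z ·_)) a A)

  dot-lincomb : ∀ {n s} (x : Vector Carrier n) (a : Vector Carrier s) (A : Vector (Vector Carrier n) s) →
                dot x (Fⁿ.lincomb n a A) ≈ dot a (λ i → dot x (A i))
  dot-lincomb x a A = ≈-trans (dot-congˡ x (λ j → reflexive (lincomb-pointwise a A j))) (dot-swap x a A)

  dot-sum≈0 : ∀ {n s} (x : Vector Carrier n) (A : Vector (Vector Carrier n) s) →
              (∀ i → dot x (A i) ≈ 0#) → dot x (sumⁿ A) ≈ 0#
  dot-sum≈0 {s = zero}  x A x⊥A = dot-zeroʳ x
  dot-sum≈0 {s = suc s} x A x⊥A =
    ≈-trans (dot-+ x (A zero) (sumⁿ (A ∘ suc)))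
            (≈-trans (+-cong (x⊥A zero) (dot-sum≈0 x (A ∘ suc) (x⊥A ∘ suc))) (+-identityˡ 0#))

  module _ {N} (order : Inverse ≈-setoid (setoid (Fin N))) where
    open Inverse order using (to; from; to-cong; strictlyInverseˡ; strictlyInverseʳ)

    to-injective : Injective _≈_ _≡_ to
    to-injective = Injection.injective (Inverse⇒Injection order)

    from-injective : Injective _≡_ _≈_ from
    from-injective {i} {j} eq =
      trans (sym (strictlyInverseˡ i))
            (trans (to-cong eq) (strictlyInverseˡ j))

    _≈?_ : Decidable _≈_
    _≈?_ = via-injection (Inverse⇒Injection order) _≟_

    -- Exhaustive search through the field; this makes the search for an invertible entry of a
    -- vector constructive.
    hasInverse? : ∀ x → Dec (∃[ y ] y · x ≈ 1#)
    hasInverse? x = map′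
      (λ (i , eq) → from i , eq)
      (λ (y , eq) → to y , ≈-trans (*-congʳ (strictlyInverseʳ y)) eq)
      (any? (λ i → (from i · x) ≈? 1#))

    -- By tightness it is enough to refute `x # 0#`, and apartness from zero would supply an inverse
    -- of `x - 0#`, hence of `x`.
    ¬hasInverse⇒≈0 : ∀ {x} → ¬ (∃[ y ] y · x ≈ 1#) → x ≈ 0#
    ¬hasInverse⇒≈0 {x} none = proj₁ (tight x 0#) λ x#0 →
      let y , y·[x-0]≈1 , _ = #⇒invertible x#0
          x≈x-0 = ≈-trans (≈-sym (+-identityʳ x)) (+-congˡ (≈-sym -0#≈0#))
      in none (y , ≈-trans (*-congˡ x≈x-0) y·[x-0]≈1)

    -- If b aᵢ = 1, then eⱼ - (b aⱼ) eᵢ is orthogonal to a.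
    orthogonal⊆⇒multiple : ∀ {s} (a a′ : Vector Carrier s) →
                           (∀ y → dot a y ≈ 0# → dot a′ y ≈ 0#) →
                           ∃[ α ] (∀ j → a′ j ≈ α · a j)
    orthogonal⊆⇒multiple {s} a a′ imp with any? (λ i → hasInverse? (a i))
    -- Here `a` is zero, so every unit vector is orthogonal to it and `a′` vanishes as well.
    ... | no none = 0# , λ j → begin
      a′ j                    ≈⟨ dot-unitVector a′ j ⟨
      dot a′ (unitVector j)   ≈⟨ imp _ (≈-trans (dot-unitVector a j)
                                   (¬hasInverse⇒≈0 (λ inv → none (j , inv)))) ⟩
      0#                      ≈⟨ zeroˡ (a j) ⟨
      0# · a j                ∎
    -- The factor is found by applying `a′` to the orthogonal vector `y j`: the result
    -- `a′ j - (b · a j) · a′ i` must be zero.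
    ... | yes (i , b , b·aᵢ≈1) = a′ i · b , λ j →
      ≈-trans (x∙y⁻¹≈ε⇒x≈y (a′ j) ((b · a j) · a′ i) (begin
        a′ j + - ((b · a j) · a′ i) ≈⟨ dot-y j a′ ⟨
        dot a′ (y j)                ≈⟨ imp (y j) (begin
          dot a (y j)                 ≈⟨ dot-y j a ⟩
          a j + - ((b · a j) · a i)   ≈⟨ +-congˡ (-‿cong (b·aⱼ·aᵢ≈aⱼ j)) ⟩
          a j + - a j                 ≈⟨ -‿inverseʳ (a j) ⟩
          0#                          ∎) ⟩
        0#                          ∎))
      (≈-trans (·-comm _ _) (≈-sym (*-assoc _ _ _)))
      where
      open CommutativeSemigroupProperties *-commutativeSemigroup using (xy∙z≈xz∙y)

      y : Fin s → Vector Carrier s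
      y j = zipWith _+_ (unitVector j) (map (- (b · a j) ·_) (unitVector i))

      b·aⱼ·aᵢ≈aⱼ : ∀ j → (b · a j) · a i ≈ a j
      b·aⱼ·aᵢ≈aⱼ j = ≈-trans (xy∙z≈xz∙y b (a j) (a i))
                             (≈-trans (*-congʳ b·aᵢ≈1) (*-identityˡ (a j)))

      dot-y : ∀ j (z : Vector Carrier s) → dot z (y j) ≈ z j + - ((b · a j) · z i)
      dot-y j z = begin
        dot z (y j)                                                ≈⟨ dot-+ z _ _ ⟩
        dot z (unitVector j) + dot z (map (- (b · a j) ·_) (unitVector i))
          ≈⟨ +-cong (dot-unitVector z j) (≈-trans (dot-scale z _ _) (*-congˡ (dot-unitVector z i))) ⟩
        z j + - (b · a j) · z i                                    ≈⟨ +-congˡ (-‿distribˡ-* _ _) ⟨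
        z j + - ((b · a j) · z i)                                  ∎

-- The pairing of 𝕂-vectors with 𝕃-vectors, and orthogonality to the rank support.

module RankSupport {q m a ℓa ℓa′ b ℓb ℓb′}
                   (E : FiniteFieldExtension q m a ℓa ℓa′ b ℓb ℓb′)
                   (Γ : FiniteFieldExtension.OrderedBasis E) where
  open FiniteFieldExtension E hiding (module K; module L)
  open FiniteFieldExtension.OrderedBasis Γ
  open RankMetric E Γ
  open Linear.IsBasisOf isBasis using (spanning; independent)
  open IsRingHomomorphism ι-isHomomorphism using (⟦⟧-cong; +-homo; *-homo; 0#-homo)

  private
    module FK = FiniteField K
    module FL = FiniteField L
    module K = CommutativeRing FK.commutativeRing
    module L = CommutativeRing FL.commutativeRing

  ι-dot : ∀ {n} (x y : Vector 𝕂 n) → FL.dot (ι ∘ x) (ι ∘ y) L.≈ ι (FK.dot x y)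
  ι-dot {zero}  x y = L.sym 0#-homo
  ι-dot {suc n} x y = L.sym (L.trans (+-homo _ _)
    (L.+-cong (*-homo _ _) (L.sym (ι-dot (x ∘ suc) (y ∘ suc)))))

  pairing : ∀ {n} → Vector 𝕂 n → Vector 𝕃 n → 𝕃
  pairing x v = FL.dot (ι ∘ x) v

  -- These are the rows of the transposed coordinate matrix, so `σ v` is by definition their span.
  column : ∀ {n} → Vector 𝕃 n → Fin m → Vector 𝕂 n
  column v i j = coordinateMatrix v j i

  -- Expanding each `v j` in the basis `γ` and exchanging the sums shows that the `γ`-coordinates of
  -- the pairing are the dot products of `x` with the columns.
  pairing≈lincomb : ∀ {n} (x : Vector 𝕂 n) v →
                    pairing x v L.≈ FL.dot (λ i → ι (FK.dot x (column v i))) γ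
  pairing≈lincomb x v = begin
    FL.dot (ι ∘ x) v
      ≈⟨ FL.dot-congˡ (ι ∘ x) (λ j → L.trans (proj₂ (spanning {v j} _))
                                             (FL.dot-comm (ι ∘ coordinateMatrix v j) γ)) ⟩
    FL.dot (ι ∘ x) (λ j → FL.dot γ (λ i → ι (column v i j)))
      ≈⟨ FL.dot-swap (ι ∘ x) γ (λ i → ι ∘ column v i) ⟩
    FL.dot γ (λ i → FL.dot (ι ∘ x) (ι ∘ column v i))
      ≈⟨ FL.dot-congˡ γ (λ i → ι-dot x (column v i)) ⟩
    FL.dot γ (λ i → ι (FK.dot x (column v i)))
      ≈⟨ FL.dot-comm γ _ ⟩
    FL.dot (λ i → ι (FK.dot x (column v i))) γ ∎
    where open SetoidReasoning L.setoid

  -- Independence of `γ` makes every coordinate of the vanishing pairing zero, so `x` is orthogonal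
  -- to each column and thus to their span.
  pairing≈0⇒⊥σ : ∀ {n} (x : Vector 𝕂 n) v → pairing x v L.≈ L.0# →
                 ∀ {y} → y ∈ σ v → FK.dot x y K.≈ K.0#
  pairing≈0⇒⊥σ x v x⊥v (c , y≈) =
    K.trans (FK.dot-congˡ x y≈)
    (K.trans (FK.dot-lincomb x c (column v))
    (K.trans (FK.dot-congˡ c (independent _ (L.trans (L.sym (pairing≈lincomb x v)) x⊥v)))
             (FK.dot-zeroʳ c)))

  ⊥σ⇒pairing≈0 : ∀ {n} (x : Vector 𝕂 n) v → (∀ {y} → y ∈ σ v → FK.dot x y K.≈ K.0#) →
                 pairing x v L.≈ L.0#
  ⊥σ⇒pairing≈0 x v x⊥σ =
    L.trans (pairing≈lincomb x v)
    (L.trans (FL.dot-comm _ γ)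
    (L.trans (FL.dot-congˡ γ (λ i → L.trans (⟦⟧-cong (x⊥σ (column∈σ i))) 0#-homo))
             (FL.dot-zeroʳ γ)))
    where
    column∈σ : ∀ i → column v i ∈ σ v
    column∈σ i = FK.unitVector i , λ j → K.sym
      (K.trans (K.reflexive (FK.lincomb-pointwise (FK.unitVector i) (column v) j))
      (K.trans (FK.dot-comm (FK.unitVector i) _) (FK.dot-unitVector (coordinateMatrix v j) i)))

  -- Bijectivity of the map φ.

  nondegenerate⇒separating : ∀ {n p} {C : Pred (Vector 𝕃 n) p} → Nondegenerate C →
    ∀ x → (∀ {v} → v ∈ C → pairing x v L.≈ L.0#) → ∀ j → x j K.≈ K.0#
  nondegenerate⇒separating (_ , all) x x⊥C j with all {FK.unitVector j} _
  -- Nondegeneracy writes the unit vector at `j` as a sum of support elements. Each is orthogonal to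
  -- `x`, hence so is the unit vector, and `x j` is zero.
  ... | _ , v , y , v∈C , y∈σ , eⱼ≈ =
    K.trans (K.sym (FK.dot-unitVector x j))
    (K.trans (FK.dot-congˡ x eⱼ≈)
             (FK.dot-sum≈0 x y (λ t → pairing≈0⇒⊥σ x (v t) (x⊥C (v∈C t)) (y∈σ t))))

  pairing-basis : ∀ {n k} (x : Vector 𝕂 n) (c : Vector 𝕃 k) (g : Vector (Vector 𝕃 n) k) {v} →
    (∀ j → v j L.≈ Linear.lincomb L.rawRing (FieldOps.vectorSpace L n) c g j) →
    pairing x v L.≈ FL.dot c (λ i → pairing x (g i))
  pairing-basis x c g v≈ = L.trans (FL.dot-congˡ (ι ∘ x) v≈) (FL.dot-lincomb (ι ∘ x) c g)

  -- If `x` and `x′` have the same image, their difference pairs to zero with the basis, hence with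
  -- the whole code, and nondegeneracy makes it zero.
  pairings-injective : ∀ {n k p} {C : Pred (Vector 𝕃 n) p} → Nondegenerate C →
    {g : Vector (Vector 𝕃 n) k} → Linear.IsBasisOf L.rawRing (FieldOps.vectorSpace L n) C g →
    Injective (λ x x′ → ∀ j → x j K.≈ x′ j) (λ y y′ → ∀ i → y i L.≈ y′ i)
              (λ x i → pairing x (g i))
  pairings-injective {C = C} nondeg {g} basis {x} {x′} eq j =
    x∙y⁻¹≈ε⇒x≈y (x j) (x′ j) (nondegenerate⇒separating {C = C} nondeg d d⊥C j)
    where
    open GroupProperties K.+-group using (x∙y⁻¹≈ε⇒x≈y)
    open GroupProperties L.+-group using (∙-cancelʳ)
    open SetoidReasoning L.setoid

    d : Vector 𝕂 _
    d l = x l K.- x′ l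

    d+x′≈x : ∀ l → d l K.+ x′ l K.≈ x l
    d+x′≈x l = K.trans (K.+-assoc _ _ _)
      (K.trans (K.+-congˡ (K.-‿inverseˡ (x′ l))) (K.+-identityʳ (x l)))

    d⊥g : ∀ i → pairing d (g i) L.≈ L.0#
    -- Adding the pairing with `x′` to both sides reduces the claim to additivity of `ι`, since
    -- `d + x′` is `x`.
    d⊥g i = ∙-cancelʳ (pairing x′ (g i)) _ _ (begin
      pairing d (g i) L.+ pairing x′ (g i)
        ≈⟨ L.+-cong (FL.dot-comm _ (g i)) (FL.dot-comm _ (g i)) ⟩
      FL.dot (g i) (ι ∘ d) L.+ FL.dot (g i) (ι ∘ x′)
        ≈⟨ FL.dot-+ (g i) (ι ∘ d) (ι ∘ x′) ⟨
      FL.dot (g i) (λ l → ι (d l) L.+ ι (x′ l))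
        ≈⟨ FL.dot-congˡ (g i) (λ l → L.trans (L.sym (+-homo _ _)) (⟦⟧-cong (d+x′≈x l))) ⟩
      FL.dot (g i) (ι ∘ x)                       ≈⟨ FL.dot-comm (g i) _ ⟩
      pairing x (g i)                            ≈⟨ eq i ⟩
      pairing x′ (g i)                           ≈⟨ L.+-identityˡ _ ⟨
      L.0# L.+ pairing x′ (g i)                  ∎)

    d⊥C : ∀ {v} → v ∈ C → pairing d v L.≈ L.0#
    d⊥C v∈C with Linear.IsBasisOf.spanning basis v∈C
    ... | c , v≈ = L.trans (pairing-basis d c g v≈)
                     (L.trans (FL.dot-congˡ c d⊥g) (FL.dot-zeroʳ c))

  pairings-surjective : ∀ {k p} {C : Pred (Vector 𝕃 (k * m)) p} → Nondegenerate C →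
    {g : Vector (Vector 𝕃 (k * m)) k} →
    Linear.IsBasisOf L.rawRing (FieldOps.vectorSpace L (k * m)) C g →
    ∀ y → ∃[ x ] (∀ i → pairing x (g i) L.≈ y i)
  pairings-surjective {k} nondeg basis =
    finite-injective⇒surjective
      -- A number below `q ^ (k * m)` is read as its base-`q` digits, each naming an element of 𝕂.
      {e = λ i → Inverse.from K-order ∘ finToFun i}
      {g = λ y → funToFin (Inverse.to L-order ∘ y)}
      -- The length `k * m` enters here: `q ^ (k * m)` equals `(q ^ m) ^ k`, the number of vectors
      -- in 𝕃 of length `k`.
      (trans (cong (q ^_) (*-comm k m)) (sym (^-*-assoc q m k)))
      (λ {i} {i′} eq → finToFun-injective {k * m} i i′ (λ j → FK.from-injective K-order (eq j)))
      (pairings-injective nondeg basis)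
      (λ {y} {y′} eq i → FL.to-injective L-order
        (funToFin-injective (Inverse.to L-order ∘ y) (Inverse.to L-order ∘ y′) eq i))

  -- Minimality of simplex codes.

  simplex⇒minimal : ∀ {k p} {C : Pred (Vector 𝕃 (k * m)) p} → IsSimplex k C → Minimal C
  simplex⇒minimal {k} simplex {v} {v′} v∈C v′∈C σ′⊆σ =
    -- The factor comes from the coefficient vectors: `c′` is `α` times `c`, and expanding in the
    -- basis `g` carries this over to `v′` and `v`.
    α , λ j → begin
      v′ j                                 ≈⟨ v′≈ j ⟩
      Lⁿ.lincomb c′ g j                    ≡⟨ FL.lincomb-pointwise c′ g j ⟩
      FL.dot c′ (λ i → g i j)              ≈⟨ FL.dot-comm c′ _ ⟩
      FL.dot (λ i → g i j) c′              ≈⟨ FL.dot-congˡ (λ i → g i j) c′≈αc ⟩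
      FL.dot (λ i → g i j) (map (α L.*_) c) ≈⟨ FL.dot-scale (λ i → g i j) α c ⟩
      α L.* FL.dot (λ i → g i j) c         ≈⟨ L.*-congˡ (FL.dot-comm _ c) ⟩
      α L.* FL.dot c (λ i → g i j)         ≡⟨ cong (α L.*_) (FL.lincomb-pointwise c g j) ⟨
      α L.* Lⁿ.lincomb c g j               ≈⟨ L.*-congˡ (v≈ j) ⟨
      α L.* v j                            ∎
    where
    open SetoidReasoning L.setoid
    module Lⁿ = Linear L.rawRing (FieldOps.vectorSpace L (k * m))
    open IsSimplex simplex
    g = proj₁ (IsCode.dimension isCode)
    basis = proj₂ (IsCode.dimension isCode)
    c = proj₁ (Lⁿ.IsBasisOf.spanning basis v∈C)
    v≈ = proj₂ (Lⁿ.IsBasisOf.spanning basis v∈C)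
    c′ = proj₁ (Lⁿ.IsBasisOf.spanning basis v′∈C)
    v′≈ = proj₂ (Lⁿ.IsBasisOf.spanning basis v′∈C)

    -- Surjectivity of φ realises `y` by some `x` over 𝕂. Then `x` is orthogonal to `σ v`, hence to
    -- the smaller `σ v′`.
    ⊥c⇒⊥c′ : ∀ y → FL.dot c y L.≈ L.0# → FL.dot c′ y L.≈ L.0#
    ⊥c⇒⊥c′ y c⊥y with pairings-surjective nondegenerate basis y
    ... | x , φx≈y = begin
      FL.dot c′ y                          ≈⟨ FL.dot-congˡ c′ φx≈y ⟨
      FL.dot c′ (λ i → pairing x (g i))    ≈⟨ pairing-basis x c′ g v′≈ ⟨
      pairing x v′
        ≈⟨ ⊥σ⇒pairing≈0 x v′ (λ y∈σ′ → pairing≈0⇒⊥σ x v x⊥v (σ′⊆σ y∈σ′)) ⟩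
      L.0#                                 ∎
      where
      x⊥v : pairing x v L.≈ L.0#
      x⊥v = L.trans (pairing-basis x c g v≈) (L.trans (FL.dot-congˡ c φx≈y) c⊥y)

    multiple : ∃[ α ] (∀ j → c′ j L.≈ α L.* c j)
    multiple = FL.orthogonal⊆⇒multiple L-order c c′ ⊥c⇒⊥c′

    α = proj₁ multiple
    c′≈αc = proj₂ multiple

theorem6p1 : ∀ {a ℓa ℓa′ b ℓb ℓb′ p : Level} (q m k : ℕ) →
    IsPrimePower q → 1 ≤ m → 2 ≤ k →
    (E : FiniteFieldExtension q m a ℓa ℓa′ b ℓb ℓb′) →
    (Γ : FiniteFieldExtension.OrderedBasis E) →
    let open FiniteFieldExtension E using (𝕃)
        open RankMetric E Γ
    in
    (C : Pred (Vector 𝕃 (k * m)) p) →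
    IsCodeOfDistance k m C →
    IsSimplex k C →
    Minimal C
theorem6p1 _ _ _ _ _ _ E Γ _ _ = RankSupport.simplex⇒minimal E Γ
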